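{- For each notion of guarding $\mathfrak{g}$, there is a natural isomorphism \[ \theta : H^{\mathfrak{g}} \circ \mathbb{G}^{\mathfrak{g}} \; \cong \; \mathbb{H} \circ H^{\mathfrak{g}} \] such that, for all $\sigma$-structures $\mathcal{A}$ (omitting $\mathfrak{g}$), $\varepsilon_{H\mathcal{A}}\circ\theta_{\mathcal{A}} = H\varepsilon_{\mathcal{A}}$ and $\delta_{H\mathcal{A}}\circ\theta_{\mathcal{A}} = \mathbb{H}\theta_{\mathcal{A}}\circ\theta_{\mathbb{G}\mathcal{A}}\circ H\delta_{\mathcal{A}}$. Thus $\theta$ forms an Eilenberg-Moore law.
   Context: $\mathfrak{g}$ is atom, loose or clique guarding. $H^{\mathfrak{g}}$ is the functor from $\sigma$-structures to hypergraphs sending $\mathcal{A}$ to $(A,E)$ with $E$ the set of $\mathfrak{g}$-guarded subsets of $\mathcal{A}$. $\mathbb{G}^{\mathfrak{g}}$ is the guarded comonad on $\sigma$-structures and $\mathbb{H}$ the hypergraph comonad; both are built from equivalence classes $[p,a]$ of focussed plays $\langle p,a\rangle$ ($p$ a non-empty list of guarded sets, resp. hyperedges, $a$ in the last element), where $\langle p,a\rangle\sim\langle q,a'\rangle$ iff $a=a'$, $p\sqcap q$ non-empty, and $a$ lies in the last element of every play on the prefix-order paths from $p\sqcap q$ to $p$ and $q$. In $\mathbb{G}\mathcal{A}$, $R^{\mathbb{G}\mathcal{A}}=\{([p,a_1],\ldots,[p,a_r])\mid R^{\mathcal{A}}(a_1,\ldots,a_r)\}$; in $\mathbb{H}(V,E)$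 the hyperedges are $\{[p,a]\mid a\in U\}$ with $U\in E$ the last element of $p$. In both, $\varepsilon([p,a])=a$ and $\delta([[U_1,\ldots,U_n],a])=[[T_1,\ldots,T_n],[[U_1,\ldots,U_n],a]]$ with $T_j=\{[[U_1,\ldots,U_j],b]\mid b\in U_j\}$. -}

module Defs where

open import Axiom.ExcludedMiddle using (ExcludedMiddle)
open import Data.Bool using (Bool; T)
open import Data.Empty using (⊥; ⊥-elim)
open import Data.Fin as Fin using (Fin)
open import Data.List using (List; []; _∷_; map; tabulate)
open import Data.List.Relation.Unary.Any using (Any; here; there)
open import Data.Nat using (ℕ; suc; _≤_)
open import Data.Nat.Properties using (≤-refl; ≤-reflexive; ≤-trans; m≤n⇒m≤1+n; 1+n≰n)
open import Data.Product using (Σ; Σ-syntax; ∃; ∃-syntax; _×_; _,_; proj₁; proj₂)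
open import Data.Sum using (_⊎_; inj₁; inj₂)
open import Data.Vec.Functional using (Vector)
open import Function using (_∘_)
open import Function.Bundles using (Func)
open import Level using (Level; _⊔_) renaming (suc to lsuc)
open import Relation.Binary.Bundles using (Setoid)
open import Relation.Binary.PropositionalEquality as ≡ using (_≡_)
open import Relation.Binary.Structures using (IsEquivalence)
open import Relation.Nullary using (¬_; yes; no)
open import Relation.Nullary.Decidable using (⌊_⌋; toWitness; fromWitness)
import Data.List.Membership.Setoid as ListMembership
import Relation.Binary.Construct.On as On

record Category (o ℓ e : Level) : Set (lsuc (o ⊔ ℓ ⊔ e)) where
  infix  4 _≈_ _⇒_
  infixr 9 _∘C_
  field
    Obj       : Set o
    _⇒_       : Obj → Obj → Set ℓ
    _≈_       : ∀ {A B} → A ⇒ B → A ⇒ B → Set e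
    id        : ∀ {A} → A ⇒ A
    _∘C_      : ∀ {A B C} → B ⇒ C → A ⇒ B → A ⇒ C
    assoc     : ∀ {A B C D} {f : A ⇒ B} {g : B ⇒ C} {h : C ⇒ D} →
                (h ∘C g) ∘C f ≈ h ∘C (g ∘C f)
    identityˡ : ∀ {A B} {f : A ⇒ B} → id ∘C f ≈ f
    identityʳ : ∀ {A B} {f : A ⇒ B} → f ∘C id ≈ f
    equiv     : ∀ {A B} → IsEquivalence (_≈_ {A} {B})
    ∘-resp-≈  : ∀ {A B C} {f h : B ⇒ C} {g i : A ⇒ B} →
                f ≈ h → g ≈ i → f ∘C g ≈ h ∘C i

record Functor {o ℓ e o′ ℓ′ e′} (C : Category o ℓ e) (D : Category o′ ℓ′ e′)
       : Set (o ⊔ ℓ ⊔ e ⊔ o′ ⊔ ℓ′ ⊔ e′) where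
  private
    module C = Category C
    module D = Category D
  field
    F₀           : C.Obj → D.Obj
    F₁           : ∀ {A B} → A C.⇒ B → F₀ A D.⇒ F₀ B
    identity     : ∀ {A} → F₁ (C.id {A}) D.≈ D.id
    homomorphism : ∀ {X Y Z} {f : X C.⇒ Y} {g : Y C.⇒ Z} →
                   F₁ (g C.∘C f) D.≈ F₁ g D.∘C F₁ f
    F-resp-≈     : ∀ {A B} {f g : A C.⇒ B} → f C.≈ g → F₁ f D.≈ F₁ g

idF : ∀ {o ℓ e} {C : Category o ℓ e} → Functor C C
idF {C = C} = record
  { F₀           = λ A → A
  ; F₁           = λ f → f
  ; identity     = IsEquivalence.refl (Category.equiv C)
  ; homomorphism = IsEquivalence.refl (Category.equiv C)
  ; F-resp-≈     = λ p → p
  }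

infixr 9 _∘F_

_∘F_ : ∀ {o ℓ e o′ ℓ′ e′ o″ ℓ″ e″}
         {C : Category o ℓ e} {D : Category o′ ℓ′ e′} {E : Category o″ ℓ″ e″} →
       Functor D E → Functor C D → Functor C E
_∘F_ {E = E} G F = record
  { F₀           = λ A → G.F₀ (F.F₀ A)
  ; F₁           = λ f → G.F₁ (F.F₁ f)
  ; identity     = trans (G.F-resp-≈ F.identity) G.identity
  ; homomorphism = trans (G.F-resp-≈ F.homomorphism) G.homomorphism
  ; F-resp-≈     = λ p → G.F-resp-≈ (F.F-resp-≈ p)
  }
  where
  module G = Functor G
  module F = Functor F
  trans : ∀ {A B} {f g h : Category._⇒_ E A B} →
          Category._≈_ E f g → Category._≈_ E g h → Category._≈_ E f h
  trans = IsEquivalence.trans (Category.equiv E)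

record NaturalTransformation {o ℓ e o′ ℓ′ e′}
       {C : Category o ℓ e} {D : Category o′ ℓ′ e′} (F G : Functor C D)
       : Set (o ⊔ ℓ ⊔ e ⊔ o′ ⊔ ℓ′ ⊔ e′) where
  private
    module C = Category C
    module D = Category D
    module F = Functor F
    module G = Functor G
  field
    η       : ∀ X → F.F₀ X D.⇒ G.F₀ X
    commute : ∀ {X Y} (f : X C.⇒ Y) → η Y D.∘C F.F₁ f D.≈ G.F₁ f D.∘C η X

record NaturalIsomorphism {o ℓ e o′ ℓ′ e′}
       {C : Category o ℓ e} {D : Category o′ ℓ′ e′} (F G : Functor C D)
       : Set (o ⊔ ℓ ⊔ e ⊔ o′ ⊔ ℓ′ ⊔ e′) where
  private
    module D = Category D
    module F = Functor F
    module G = Functor G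
  field
    F⇒G : NaturalTransformation F G
  open NaturalTransformation F⇒G public
  field
    η⁻¹  : ∀ X → G.F₀ X D.⇒ F.F₀ X
    isoˡ : ∀ X → η⁻¹ X D.∘C η X D.≈ D.id
    isoʳ : ∀ X → η X D.∘C η⁻¹ X D.≈ D.id

record Comonad {o ℓ e} (C : Category o ℓ e) : Set (o ⊔ ℓ ⊔ e) where
  open Category C
  field
    functor : Functor C C
    counit  : NaturalTransformation functor idF
    comult  : NaturalTransformation functor (functor ∘F functor)
  open Functor functor public
  ε : ∀ X → F₀ X ⇒ X
  ε = NaturalTransformation.η counit
  δ : ∀ X → F₀ X ⇒ F₀ (F₀ X)
  δ = NaturalTransformation.η comult
  field
    counitˡ : ∀ {X} → F₁ (ε X) ∘C δ X ≈ id
    counitʳ : ∀ {X} → ε (F₀ X) ∘C δ X ≈ id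
    coassoc : ∀ {X} → F₁ (δ X) ∘C δ X ≈ δ (F₀ X) ∘C δ X

record IsEilenbergMooreLaw {o ℓ e o′ ℓ′ e′}
       {C : Category o ℓ e} {D : Category o′ ℓ′ e′}
       (G : Comonad C) (K : Comonad D) (H : Functor C D)
       (θ : NaturalTransformation (H ∘F Comonad.functor G) (Comonad.functor K ∘F H))
       : Set (o ⊔ e′) where
  private
    module G = Comonad G
    module K = Comonad K
    module H = Functor H
    module θ = NaturalTransformation θ
  open Category D
  field
    counit-law : ∀ A → K.ε (H.F₀ A) ∘C θ.η A ≈ H.F₁ (G.ε A)
    comult-law : ∀ A → K.δ (H.F₀ A) ∘C θ.η A
                         ≈ K.F₁ (θ.η A) ∘C (θ.η (G.F₀ A) ∘C H.F₁ (G.δ A))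

record Vocabulary (ℓ : Level) : Set (lsuc ℓ) where
  field
    Symbol : Set ℓ
    arity  : Symbol → ℕ

data Guarding : Set where
  atom loose clique : Guarding

-- The metatheory is classical.  Sets are setoids (the universes of 𝔾 𝒜 and
-- ℍ (V , E) are quotients), and thanks to excluded middle the powerset of V
-- is the set of its two-valued characteristic functions, which lives in the
-- same universe as V.

module Classical {ℓ : Level} (em : ExcludedMiddle ℓ) where

  open Func using (to; cong)

  ∣_∣ : Setoid ℓ ℓ → Set ℓ
  ∣ V ∣ = Setoid.Carrier V

  Subset : Setoid ℓ ℓ → Set ℓ
  Subset V = Func V (≡.setoid Bool)

  infix 4 _∈_ _⊆_ _≐_

  record _∈_ {V : Setoid ℓ ℓ} (x : ∣ V ∣) (U : Subset V) : Set where
    constructor mem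
    field holds : T (to U x)

  _⊆_ : {V : Setoid ℓ ℓ} → Subset V → Subset V → Set ℓ
  U ⊆ W = ∀ {x} → x ∈ U → x ∈ W

  _≐_ : {V : Setoid ℓ ℓ} → Subset V → Subset V → Set ℓ
  U ≐ W = (U ⊆ W) × (W ⊆ U)

  ∈-resp : {V : Setoid ℓ ℓ} (U : Subset V) {x y : ∣ V ∣} →
           Setoid._≈_ V x y → x ∈ U → y ∈ U
  ∈-resp U eq (mem h) = mem (≡.subst T (cong U eq) h)

  ≐-refl : {V : Setoid ℓ ℓ} {U : Subset V} → U ≐ U
  ≐-refl = (λ m → m) , (λ m → m)

  ≐-sym : {V : Setoid ℓ ℓ} {U W : Subset V} → U ≐ W → W ≐ U
  ≐-sym (f , g) = g , f

  ≐-trans : {V : Setoid ℓ ℓ} {U W Z : Subset V} → U ≐ W → W ≐ Z → U ≐ Z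
  ≐-trans (f , g) (h , k) = (λ m → h (f m)) , (λ m → g (k m))

  module _ {V : Setoid ℓ ℓ} (P : ∣ V ∣ → Set ℓ)
           (P-resp : ∀ {x y} → Setoid._≈_ V x y → P x → P y) where

    private
      ext : ∀ {x y} → (P x → P y) → (P y → P x) →
            ⌊ em {P = P x} ⌋ ≡ ⌊ em {P = P y} ⌋
      ext {x} {y} f g with em {P = P x} | em {P = P y}
      ... | yes _ | yes _ = ≡.refl
      ... | no  _ | no  _ = ≡.refl
      ... | yes p | no ¬q = ⊥-elim (¬q (f p))
      ... | no ¬p | yes q = ⊥-elim (¬p (g q))

    compr : Subset V
    compr = record
      { to   = λ x → ⌊ em {P = P x} ⌋
      ; cong = λ eq → ext (P-resp eq) (P-resp (Setoid.sym V eq))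
      }

    ∈-compr⁺ : ∀ {x} → P x → x ∈ compr
    ∈-compr⁺ p = mem (fromWitness p)

    ∈-compr⁻ : ∀ {x} → x ∈ compr → P x
    ∈-compr⁻ (mem h) = toWitness h

  module _ {V W : Setoid ℓ ℓ} (f : Func V W) (U : Subset V) where

    private
      module W = Setoid W

      P : ∣ W ∣ → Set ℓ
      P y = ∃[ x ] (x ∈ U) × (to f x W.≈ y)

      P-resp : ∀ {y z} → y W.≈ z → P y → P z
      P-resp eq (x , m , e) = x , m , W.trans e eq

    image : Subset W
    image = compr P P-resp

    ∈-image⁺ : ∀ {x y} → x ∈ U → to f x W.≈ y → y ∈ image
    ∈-image⁺ m e = ∈-compr⁺ P P-resp (_ , m , e)

    ∈-image⁻ : ∀ {y} → y ∈ image → ∃[ x ] (x ∈ U) × (to f x W.≈ y)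
    ∈-image⁻ = ∈-compr⁻ P P-resp

  image-resp : {V W : Setoid ℓ ℓ} (f : Func V W) {U U′ : Subset V} →
               U ≐ U′ → image f U ≐ image f U′
  image-resp f {U} {U′} (i , j) =
      (λ m → let (x , n , e) = ∈-image⁻ f U m in ∈-image⁺ f U′ (i n) e)
    , (λ m → let (x , n , e) = ∈-image⁻ f U′ m in ∈-image⁺ f U (j n) e)

  idFun : {V : Setoid ℓ ℓ} → Func V V
  idFun = record { to = λ x → x ; cong = λ e → e }

  infixr 9 _∘Fun_

  _∘Fun_ : {V W Z : Setoid ℓ ℓ} → Func W Z → Func V W → Func V Z
  g ∘Fun f = record { to = to g ∘ to f ; cong = cong g ∘ cong f }

  infix 4 _≗_

  _≗_ : {V W : Setoid ℓ ℓ} → Func V W → Func V W → Set ℓ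
  _≗_ {V} {W} f g = ∀ x → Setoid._≈_ W (to f x) (to g x)

  ≗-equiv : {V W : Setoid ℓ ℓ} → IsEquivalence (_≗_ {V} {W})
  ≗-equiv {V} {W} = record
    { refl  = λ x → Setoid.refl W
    ; sym   = λ p x → Setoid.sym W (p x)
    ; trans = λ p q x → Setoid.trans W (p x) (q x)
    }

  image-id : {V : Setoid ℓ ℓ} {U : Subset V} → image idFun U ≐ U
  image-id {V} {U} =
      (λ m → let (x , n , e) = ∈-image⁻ idFun U m in ∈-resp U e n)
    , (λ n → ∈-image⁺ idFun U n (Setoid.refl V))

  image-∘ : {V W Z : Setoid ℓ ℓ} {g : Func W Z} {f : Func V W} {U : Subset V} →
            image (g ∘Fun f) U ≐ image g (image f U)
  image-∘ {V} {W} {Z} {g} {f} {U} =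
      (λ m → let (x , n , e) = ∈-image⁻ (g ∘Fun f) U m
             in ∈-image⁺ g (image f U) (∈-image⁺ f U n W.refl) e)
    , (λ m → let (y , n , e) = ∈-image⁻ g (image f U) m
                 (x , k , d) = ∈-image⁻ f U n
             in ∈-image⁺ (g ∘Fun f) U k (Z.trans (cong g d) e))
    where
    module W = Setoid W
    module Z = Setoid Z

  image-≗ : {V W : Setoid ℓ ℓ} {f g : Func V W} {U : Subset V} →
            f ≗ g → image f U ≐ image g U
  image-≗ {V} {W} {f} {g} {U} p =
      (λ m → let (x , n , e) = ∈-image⁻ f U m
             in ∈-image⁺ g U n (W.trans (W.sym (p x)) e))
    , (λ m → let (x , n , e) = ∈-image⁻ g U m in ∈-image⁺ f U n (W.trans (p x) e))
    where module W = Setoid W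

  record Hypergraph : Set (lsuc ℓ) where
    field
      Vertex    : Setoid ℓ ℓ
      Edge      : Subset Vertex → Set ℓ
      Edge-resp : ∀ {U W} → U ≐ W → Edge U → Edge W

  open Hypergraph

  record HypHom (X Y : Hypergraph) : Set ℓ where
    field
      fun       : Func (Vertex X) (Vertex Y)
      pres-edge : ∀ {U} → Edge X U → Edge Y (image fun U)

  open HypHom

  Hyp : Category (lsuc ℓ) ℓ ℓ
  Hyp = record
    { Obj       = Hypergraph
    ; _⇒_       = HypHom
    ; _≈_       = λ f g → fun f ≗ fun g
    ; id        = λ {X} → record
        { fun       = idFun
        ; pres-edge = λ {U} → Edge-resp X (≐-sym (image-id {U = U}))
        }
    ; _∘C_      = λ {_} {_} {Z} g f → record
        { fun       = fun g ∘Fun fun f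
        ; pres-edge = λ {U} u →
            Edge-resp Z (≐-sym (image-∘ {g = fun g} {fun f} {U}))
                        (pres-edge g (pres-edge f u))
        }
    ; assoc     = λ {_} {_} {_} {D} x → Setoid.refl (Vertex D)
    ; identityˡ = λ {_} {B} x → Setoid.refl (Vertex B)
    ; identityʳ = λ {_} {B} x → Setoid.refl (Vertex B)
    ; equiv     = On.isEquivalence fun ≗-equiv
    ; ∘-resp-≈  = λ {_} {_} {C} {_} {h} p q x →
        Setoid.trans (Vertex C) (p _) (cong (fun h) (q x))
    }

  -- Plays: non-empty lists of hyperedges, most recent move last.  A play
  -- is determined by its list of sets.

  infixl 5 _▷_

  data Play (X : Hypergraph) : Set ℓ where
    [_] : ∃ (Edge X) → Play X
    _▷_ : Play X → ∃ (Edge X) → Play X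

  last : ∀ {X} → Play X → Subset (Vertex X)
  last [ U , _ ]     = U
  last (_ ▷ (U , _)) = U

  last-edge : ∀ {X} (p : Play X) → Edge X (last p)
  last-edge [ _ , u ]     = u
  last-edge (_ ▷ (_ , u)) = u

  infix 4 _≋_ _⊑_

  data _≋_ {X : Hypergraph} : Play X → Play X → Set ℓ where
    [_] : ∀ {U W} → proj₁ U ≐ proj₁ W → [ U ] ≋ [ W ]
    _▷_ : ∀ {p q U W} → p ≋ q → proj₁ U ≐ proj₁ W → p ▷ U ≋ q ▷ W

  data _⊑_ {X : Hypergraph} (p : Play X) : Play X → Set ℓ where
    ⊑-reflexive : ∀ {q} → p ≋ q → p ⊑ q
    ⊑-step      : ∀ {q U} → p ⊑ q → p ⊑ q ▷ U

  -- r = p ⊓ q.  Since plays are non-empty lists, such an r exists precisely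
  -- when the longest common prefix of p and q is non-empty.
  record IsMeet {X : Hypergraph} (r p q : Play X) : Set ℓ where
    field
      lowerˡ   : r ⊑ p
      lowerʳ   : r ⊑ q
      greatest : ∀ {s} → s ⊑ p → s ⊑ q → s ⊑ r

  record FocussedPlay (X : Hypergraph) : Set ℓ where
    constructor ⟨_,_⟩∋_
    field
      play   : Play X
      focus  : ∣ Vertex X ∣
      focus∈ : focus ∈ last play

  open FocussedPlay

  infix 4 _~_

  record _~_ {X : Hypergraph} (x y : FocussedPlay X) : Set ℓ where
    field
      focus≈ : Setoid._≈_ (Vertex X) (focus x) (focus y)
      meet   : Play X
      isMeet : IsMeet meet (play x) (play y)
      along  : ∀ s → meet ⊑ s → s ⊑ play x ⊎ s ⊑ play y → focus x ∈ last s

  ≋-refl : ∀ {X} {p : Play X} → p ≋ p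
  ≋-refl {p = [ _ ]} = [ ≐-refl ]
  ≋-refl {p = _ ▷ _} = ≋-refl ▷ ≐-refl

  ≋-sym : ∀ {X} {p q : Play X} → p ≋ q → q ≋ p
  ≋-sym {p = [ U ]} {[ W ]} [ e ] = [ ≐-sym {U = proj₁ U} {proj₁ W} e ]
  ≋-sym {p = _ ▷ U} {_ ▷ W} (d ▷ e) = ≋-sym d ▷ ≐-sym {U = proj₁ U} {proj₁ W} e

  ≋-trans : ∀ {X} {p q r : Play X} → p ≋ q → q ≋ r → p ≋ r
  ≋-trans {p = [ U ]} {[ W ]} {[ Z ]} [ d ] [ e ] =
    [ ≐-trans {U = proj₁ U} {proj₁ W} {proj₁ Z} d e ]
  ≋-trans {p = _ ▷ U} {_ ▷ W} {_ ▷ Z} (c ▷ d) (c′ ▷ e) =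
    ≋-trans c c′ ▷ ≐-trans {U = proj₁ U} {proj₁ W} {proj₁ Z} d e

  ≋-last : ∀ {X} {p q : Play X} → p ≋ q → last p ≐ last q
  ≋-last [ e ]   = e
  ≋-last (_ ▷ e) = e

  ⊑-respʳ : ∀ {X} {p q r : Play X} → p ⊑ q → q ≋ r → p ⊑ r
  ⊑-respʳ (⊑-reflexive d) e       = ⊑-reflexive (≋-trans d e)
  ⊑-respʳ (⊑-step l)      (e ▷ _) = ⊑-step (⊑-respʳ l e)

  ⊑-trans : ∀ {X} {p q r : Play X} → p ⊑ q → q ⊑ r → p ⊑ r
  ⊑-trans l (⊑-reflexive e) = ⊑-respʳ l e
  ⊑-trans l (⊑-step m)      = ⊑-step (⊑-trans l m)

  length : ∀ {X} → Play X → ℕ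
  length [ _ ]   = 1
  length (p ▷ _) = suc (length p)

  ≋-length : ∀ {X} {p q : Play X} → p ≋ q → length p ≡ length q
  ≋-length [ _ ]   = ≡.refl
  ≋-length (e ▷ _) = ≡.cong suc (≋-length e)

  ⊑-length : ∀ {X} {p q : Play X} → p ⊑ q → length p ≤ length q
  ⊑-length (⊑-reflexive e) = ≤-reflexive (≋-length e)
  ⊑-length (⊑-step l)      = m≤n⇒m≤1+n (⊑-length l)

  ⊑-antisym : ∀ {X} {p q : Play X} → p ⊑ q → q ⊑ p → p ≋ q
  ⊑-antisym (⊑-reflexive e) _ = e
  ⊑-antisym (⊑-step l)      m = ⊥-elim (1+n≰n (≤-trans (⊑-length m) (⊑-length l)))

  -- Walk a r p: r is a prefix of p, and a lies in the last element of every
  -- play between them.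
  data Walk {X : Hypergraph} (a : ∣ Vertex X ∣) (r : Play X) : Play X → Set ℓ where
    stay : ∀ {p} → r ≋ p → a ∈ last p → Walk a r p
    step : ∀ {p U} → Walk a r p → a ∈ proj₁ U → Walk a r (p ▷ U)

  walk⇒⊑ : ∀ {X a} {r p : Play X} → Walk a r p → r ⊑ p
  walk⇒⊑ (stay e _) = ⊑-reflexive e
  walk⇒⊑ (step w _) = ⊑-step (walk⇒⊑ w)

  walk⇒along : ∀ {X a} {r p s : Play X} → Walk a r p → r ⊑ s → s ⊑ p → a ∈ last s
  walk⇒along (stay e m) l k =
    proj₂ (≋-last (⊑-antisym k (⊑-trans (⊑-reflexive (≋-sym e)) l))) m
  walk⇒along (step w m) l (⊑-reflexive e) = proj₂ (≋-last e) m
  walk⇒along (step w m) l (⊑-step k)      = walk⇒along w l k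

  along⇒walk : ∀ {X a} {r p : Play X} → r ⊑ p →
               (∀ s → r ⊑ s → s ⊑ p → a ∈ last s) → Walk a r p
  along⇒walk (⊑-reflexive e) h = stay e (h _ (⊑-reflexive e) (⊑-reflexive ≋-refl))
  along⇒walk (⊑-step l)      h =
    step (along⇒walk l (λ s i j → h s i (⊑-step j)))
         (h _ (⊑-step l) (⊑-reflexive ≋-refl))

  walk-≈ : ∀ {X a b} {r p : Play X} → Setoid._≈_ (Vertex X) a b →
           Walk a r p → Walk b r p
  walk-≈ eq (stay {p} e m)     = stay e (∈-resp (last p) eq m)
  walk-≈ eq (step {U = U} w m) = step (walk-≈ eq w) (∈-resp (proj₁ U) eq m)

  walk-respˡ : ∀ {X a} {r r′ p : Play X} → r′ ≋ r → Walk a r p → Walk a r′ p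
  walk-respˡ d (stay e m) = stay (≋-trans d e) m
  walk-respˡ d (step w m) = step (walk-respˡ d w) m

  walk-respʳ : ∀ {X a} {r p q : Play X} → p ≋ q → Walk a r p → Walk a r q
  walk-respʳ d       (stay e m) = stay (≋-trans e d) (proj₁ (≋-last d) m)
  walk-respʳ (d ▷ e) (step w m) = step (walk-respʳ d w) (proj₁ e m)

  walk-trans : ∀ {X a} {r p q : Play X} → Walk a r p → Walk a p q → Walk a r q
  walk-trans w (stay e _) = walk-respʳ e w
  walk-trans w (step v m) = step (walk-trans w v) m

  walk-compare : ∀ {X a} {r s p : Play X} → Walk a r p → Walk a s p →
                 Walk a r s ⊎ Walk a s r
  walk-compare (stay e _)   v            = inj₂ (walk-respʳ (≋-sym e) v)
  walk-compare w@(step _ _) (stay e _)   = inj₁ (walk-respʳ (≋-sym e) w)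
  walk-compare (step w _)   (step v _)   = walk-compare w v

  meet-exists : ∀ {X} {r : Play X} (p q : Play X) → r ⊑ p → r ⊑ q →
                ∃[ m ] IsMeet m p q × r ⊑ m
  meet-exists p q l k with em {P = p ⊑ q}
  meet-exists p q l k | yes p⊑q =
    p , record { lowerˡ = ⊑-reflexive ≋-refl ; lowerʳ = p⊑q ; greatest = λ i _ → i } , l
  meet-exists p q (⊑-reflexive e) k | no p⋢q =
    ⊥-elim (p⋢q (⊑-trans (⊑-reflexive (≋-sym e)) k))
  meet-exists (p ▷ U) q (⊑-step l) k | no p⋢q =
    let (m , isM , r⊑m) = meet-exists p q l k
        open IsMeet isM
    in m , record
         { lowerˡ   = ⊑-step lowerˡ
         ; lowerʳ   = lowerʳ
         ; greatest = λ where
             (⊑-reflexive e) j → ⊥-elim (p⋢q (⊑-trans (⊑-reflexive (≋-sym e)) j))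
             (⊑-step i)      j → greatest i j
         } , r⊑m

  ~⇒walks : ∀ {X} {x y : FocussedPlay X} → x ~ y →
            ∃[ r ] Walk (focus x) r (play x) × Walk (focus x) r (play y)
  ~⇒walks x~y = meet
    , along⇒walk (IsMeet.lowerˡ isMeet) (λ s i j → along s i (inj₁ j))
    , along⇒walk (IsMeet.lowerʳ isMeet) (λ s i j → along s i (inj₂ j))
    where open _~_ x~y

  walks⇒~ : ∀ {X} {x y : FocussedPlay X} {r} →
            Setoid._≈_ (Vertex X) (focus x) (focus y) →
            Walk (focus x) r (play x) → Walk (focus x) r (play y) → x ~ y
  walks⇒~ {x = x} {y} eq w v =
    let (m , isM , r⊑m) = meet-exists (play x) (play y) (walk⇒⊑ w) (walk⇒⊑ v)
    in record
      { focus≈ = eq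
      ; meet   = m
      ; isMeet = isM
      ; along  = λ where
          s i (inj₁ j) → walk⇒along w (⊑-trans r⊑m i) j
          s i (inj₂ j) → walk⇒along v (⊑-trans r⊑m i) j
      }

  ≋⇒~ : ∀ {X} {x y : FocussedPlay X} → play x ≋ play y →
        Setoid._≈_ (Vertex X) (focus x) (focus y) → x ~ y
  ≋⇒~ {x = x} e eq =
    walks⇒~ eq (stay ≋-refl (focus∈ x)) (stay e (proj₁ (≋-last e) (focus∈ x)))

  ~-extend : ∀ {X} (p : Play X) (U : ∃ (Edge X)) {a} (m : a ∈ last p) (n : a ∈ proj₁ U) →
             (⟨ p , a ⟩∋ m) ~ (⟨ p ▷ U , a ⟩∋ n)
  ~-extend {X} p U m n =
    walks⇒~ (Setoid.refl (Vertex X)) (stay ≋-refl m) (step (stay ≋-refl m) n)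

  ~-refl : ∀ {X} {x : FocussedPlay X} → x ~ x
  ~-refl {X} = ≋⇒~ ≋-refl (Setoid.refl (Vertex X))

  ~-sym : ∀ {X} {x y : FocussedPlay X} → x ~ y → y ~ x
  ~-sym {X} x~y =
    let (r , w , v) = ~⇒walks x~y
        eq          = _~_.focus≈ x~y
    in walks⇒~ (Setoid.sym (Vertex X) eq) (walk-≈ eq v) (walk-≈ eq w)

  ~-trans : ∀ {X} {x y z : FocussedPlay X} → x ~ y → y ~ z → x ~ z
  ~-trans {X} {x} {y} {z} x~y y~z = compare (walk-compare v w′)
    where
    module V = Setoid (Vertex X)
    eq = _~_.focus≈ x~y
    eq′ = V.trans eq (_~_.focus≈ y~z)
    r  = proj₁ (~⇒walks x~y)
    w  = proj₁ (proj₂ (~⇒walks x~y))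
    v  = proj₂ (proj₂ (~⇒walks x~y))
    r′ = proj₁ (~⇒walks y~z)
    w′ = walk-≈ (V.sym eq) (proj₁ (proj₂ (~⇒walks y~z)))
    v′ = walk-≈ (V.sym eq) (proj₂ (proj₂ (~⇒walks y~z)))
    compare : Walk (focus x) r r′ ⊎ Walk (focus x) r′ r → x ~ z
    compare (inj₁ u) = walks⇒~ eq′ w (walk-trans u v′)
    compare (inj₂ u) = walks⇒~ eq′ (walk-trans u w) v′

  Classes : Hypergraph → Setoid ℓ ℓ
  Classes X = record
    { Carrier       = FocussedPlay X
    ; _≈_           = _~_
    ; isEquivalence = record { refl = ~-refl ; sym = ~-sym ; trans = ~-trans }
    }

  -- {[p,a] | a ∈ U}, where U is the last element of p.
  module _ {X : Hypergraph} (p : Play X) where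

    private
      P : FocussedPlay X → Set ℓ
      P x = ∃[ a ] Σ[ m ∈ a ∈ last p ] x ~ (⟨ p , a ⟩∋ m)

      P-resp : ∀ {x y} → x ~ y → P x → P y
      P-resp eq (a , m , e) = a , m , ~-trans (~-sym eq) e

    cell : Subset (Classes X)
    cell = compr P P-resp

    ∈-cell⁺ : ∀ {x a} (m : a ∈ last p) → x ~ (⟨ p , a ⟩∋ m) → x ∈ cell
    ∈-cell⁺ m e = ∈-compr⁺ P P-resp (_ , m , e)

    ∈-cell⁻ : ∀ {x} → x ∈ cell → ∃[ a ] Σ[ m ∈ a ∈ last p ] x ~ (⟨ p , a ⟩∋ m)
    ∈-cell⁻ = ∈-compr⁻ P P-resp

  cell-cong : ∀ {X} {p q : Play X} → p ≋ q → cell p ≐ cell q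
  cell-cong {X} {p} {q} e =
      (λ k → let (a , m , d) = ∈-cell⁻ p k
             in ∈-cell⁺ q (proj₁ (≋-last e) m) (~-trans d (≋⇒~ e (Setoid.refl (Vertex X)))))
    , (λ k → let (a , m , d) = ∈-cell⁻ q k
             in ∈-cell⁺ p (proj₂ (≋-last e) m)
                  (~-trans d (≋⇒~ (≋-sym e) (Setoid.refl (Vertex X)))))

  -- Action of morphisms: [[U₁,…,Uₙ],a] ↦ [[f(U₁),…,f(Uₙ)],f(a)].

  module _ {X Y : Hypergraph} (f : HypHom X Y) where

    private
      module X = Setoid (Vertex X)
      module Y = Setoid (Vertex Y)

    mapEdge : ∃ (Edge X) → ∃ (Edge Y)
    mapEdge (U , u) = image (fun f) U , pres-edge f u

    mapPlay : Play X → Play Y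
    mapPlay [ U ]   = [ mapEdge U ]
    mapPlay (p ▷ U) = mapPlay p ▷ mapEdge U

    last-map : ∀ p → last (mapPlay p) ≡ image (fun f) (last p)
    last-map [ _ ]   = ≡.refl
    last-map (_ ▷ _) = ≡.refl

    ∈-last-map⁺ : ∀ p {a} → a ∈ last p → to (fun f) a ∈ last (mapPlay p)
    ∈-last-map⁺ p {a} m rewrite last-map p = ∈-image⁺ (fun f) (last p) m Y.refl

    ∈-last-map⁻ : ∀ p {b} → b ∈ last (mapPlay p) →
                  ∃[ a ] (a ∈ last p) × (to (fun f) a Y.≈ b)
    ∈-last-map⁻ p m rewrite last-map p = ∈-image⁻ (fun f) (last p) m

    mapPlay-cong : ∀ {p q} → p ≋ q → mapPlay p ≋ mapPlay q
    mapPlay-cong {[ U ]} {[ W ]} [ e ]     = [ image-resp (fun f) {proj₁ U} {proj₁ W} e ]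
    mapPlay-cong {_ ▷ U} {_ ▷ W} (d ▷ e)   =
      mapPlay-cong d ▷ image-resp (fun f) {proj₁ U} {proj₁ W} e

    mapWalk : ∀ {a r p} → Walk a r p → Walk (to (fun f) a) (mapPlay r) (mapPlay p)
    mapWalk (stay {p} e m)         = stay (mapPlay-cong e) (∈-last-map⁺ p m)
    mapWalk (step {U = U , _} w m) = step (mapWalk w) (∈-image⁺ (fun f) U m Y.refl)

    mapFocussed : FocussedPlay X → FocussedPlay Y
    mapFocussed (⟨ p , a ⟩∋ m) = ⟨ mapPlay p , to (fun f) a ⟩∋ ∈-last-map⁺ p m

    mapClasses : Func (Classes X) (Classes Y)
    mapClasses = record
      { to   = mapFocussed
      ; cong = λ x~y → let (r , w , v) = ~⇒walks x~y in
          walks⇒~ (cong (fun f) (_~_.focus≈ x~y)) (mapWalk w) (mapWalk v)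
      }

    image-cell : ∀ p → image mapClasses (cell p) ≐ cell (mapPlay p)
    image-cell p =
        (λ k → let (x , n , e) = ∈-image⁻ mapClasses (cell p) k
                   (a , m , d) = ∈-cell⁻ p n
               in ∈-cell⁺ (mapPlay p) (∈-last-map⁺ p m)
                    (~-trans (~-sym e) (cong mapClasses d)))
      , (λ k → let (b , m , d) = ∈-cell⁻ (mapPlay p) k
                   (a , n , e) = ∈-last-map⁻ p m
               in ∈-image⁺ mapClasses (cell p) (∈-cell⁺ p n ~-refl)
                    (~-trans (≋⇒~ ≋-refl e) (~-sym d)))

  mapPlay-≗ : ∀ {X Y} (f g : HypHom X Y) → fun f ≗ fun g → ∀ p → mapPlay f p ≋ mapPlay g p
  mapPlay-≗ f g e [ U , _ ]     = [ image-≗ {f = fun f} {fun g} {U} e ]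
  mapPlay-≗ f g e (p ▷ (U , _)) = mapPlay-≗ f g e p ▷ image-≗ {f = fun f} {fun g} {U} e

  mapPlay-id : ∀ {X} (f : HypHom X X) → fun f ≗ idFun → ∀ p → mapPlay f p ≋ p
  mapPlay-id {X} f e = go
    where
    eq : ∀ U → image (fun f) U ≐ U
    eq U = ≐-trans {U = image (fun f) U} {image idFun U} {U}
             (image-≗ {f = fun f} {idFun} {U} e) (image-id {U = U})
    go : ∀ p → mapPlay f p ≋ p
    go [ U , _ ]     = [ eq U ]
    go (p ▷ (U , _)) = go p ▷ eq U

  mapPlay-∘ : ∀ {X Y Z} (h : HypHom X Z) (g : HypHom Y Z) (f : HypHom X Y) →
              fun h ≗ fun g ∘Fun fun f → ∀ p → mapPlay h p ≋ mapPlay g (mapPlay f p)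
  mapPlay-∘ h g f e = go
    where
    eq : ∀ U → image (fun h) U ≐ image (fun g) (image (fun f) U)
    eq U = ≐-trans {U = image (fun h) U} {image (fun g ∘Fun fun f) U}
             {image (fun g) (image (fun f) U)}
             (image-≗ {f = fun h} {fun g ∘Fun fun f} {U} e)
             (image-∘ {g = fun g} {fun f} {U})
    go : ∀ p → mapPlay h p ≋ mapPlay g (mapPlay f p)
    go [ U , _ ]     = [ eq U ]
    go (p ▷ (U , _)) = go p ▷ eq U

  focusFun : (X : Hypergraph) → Func (Classes X) (Vertex X)
  focusFun X = record { to = focus ; cong = _~_.focus≈ }

  image-focus-cell : ∀ {X} (p : Play X) → image (focusFun X) (cell p) ≐ last p
  image-focus-cell {X} p =
      (λ k → let (x , n , e) = ∈-image⁻ (focusFun X) (cell p) k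
                 (a , m , d) = ∈-cell⁻ p n
             in ∈-resp (last p) (V.trans (V.sym (_~_.focus≈ d)) e) m)
    , (λ m → ∈-image⁺ (focusFun X) (cell p) (∈-cell⁺ p m ~-refl) V.refl)
    where module V = Setoid (Vertex X)

  -- δ([[U₁,…,Uₙ],a]) = [[T₁,…,Tₙ],[[U₁,…,Uₙ],a]], for any hypergraph
  -- structure on the classes in which the sets Tⱼ = cell [U₁,…,Uⱼ] are
  -- hyperedges.

  record Celled (X : Hypergraph) : Set (lsuc ℓ) where
    field
      Edge*      : Subset (Classes X) → Set ℓ
      Edge*-resp : ∀ {S T} → S ≐ T → Edge* S → Edge* T
      cell-edge  : ∀ p → Edge* (cell p)
    hypergraph : Hypergraph
    hypergraph = record { Vertex = Classes X ; Edge = Edge* ; Edge-resp = Edge*-resp }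

  module Unfold {X : Hypergraph} (C : Celled X) where
    open Celled C using (cell-edge) renaming (hypergraph to Y)

    unfold : Play X → Play Y
    unfold [ U ]   = [ cell [ U ] , cell-edge [ U ] ]
    unfold (p ▷ U) = unfold p ▷ (cell (p ▷ U) , cell-edge (p ▷ U))

    last-unfold : ∀ p → last (unfold p) ≡ cell p
    last-unfold [ _ ]   = ≡.refl
    last-unfold (_ ▷ _) = ≡.refl

    ∈-unfold⁺ : ∀ p {x} → x ∈ cell p → x ∈ last (unfold p)
    ∈-unfold⁺ p m rewrite last-unfold p = m

    ∈-unfold⁻ : ∀ p {x} → x ∈ last (unfold p) → x ∈ cell p
    ∈-unfold⁻ p m rewrite last-unfold p = m

    unfold-cong : ∀ {p q} → p ≋ q → unfold p ≋ unfold q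
    unfold-cong e@([ _ ]) = [ cell-cong e ]
    unfold-cong e@(d ▷ _) = unfold-cong d ▷ cell-cong e

    unfoldFocussed : FocussedPlay X → FocussedPlay Y
    unfoldFocussed x@(⟨ p , a ⟩∋ m) = ⟨ unfold p , x ⟩∋ ∈-unfold⁺ p (∈-cell⁺ p m ~-refl)

    walk-start : ∀ {a} {r p : Play X} → Walk a r p → a ∈ last r
    walk-start (stay e m) = proj₂ (≋-last e) m
    walk-start (step w _) = walk-start w

    unfold-walk : ∀ {a r p} (x : FocussedPlay X) (n : a ∈ last r) → x ~ (⟨ r , a ⟩∋ n) →
                  Walk a r p → Walk x (unfold r) (unfold p)
    unfold-walk x n e w@(stay {p} d m) =
      stay (unfold-cong d)
           (∈-unfold⁺ p (∈-cell⁺ p m (~-trans e (≋⇒~ d (Setoid.refl (Vertex X))))))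
    unfold-walk {a} {r} x n e w@(step {p} {U} v m) =
      step (unfold-walk x n e v)
           (∈-cell⁺ (p ▷ U) m
             (~-trans e (walks⇒~ (Setoid.refl (Vertex X)) (stay ≋-refl n) w)))

    δFun : Func (Classes X) (Classes Y)
    δFun = record
      { to   = unfoldFocussed
      ; cong = λ {x} {y} x~y →
          let (r , w , v) = ~⇒walks x~y
              n = walk-start w
              e = walks⇒~ {x = x} {⟨ r , focus x ⟩∋ n} (Setoid.refl (Vertex X))
                          w (stay ≋-refl n)
          in walks⇒~ x~y (unfold-walk x n e w) (unfold-walk x n e v)
      }

    image-δ-cell : ∀ p → image δFun (cell p) ≐ cell (unfold p)
    image-δ-cell p =
        (λ k → let (x , n , e) = ∈-image⁻ δFun (cell p) k
                   (a , m , d) = ∈-cell⁻ p n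
               in ∈-cell⁺ (unfold p) (∈-unfold⁺ p (∈-cell⁺ p m ~-refl))
                    (~-trans (~-sym e) (cong δFun d)))
      , (λ k → let (x , m , d) = ∈-cell⁻ (unfold p) k
                   (a , n , e) = ∈-cell⁻ p (∈-unfold⁻ p m)
               in ∈-image⁺ δFun (cell p) (∈-cell⁺ p n ~-refl)
                    (~-trans (≋⇒~ ≋-refl (~-sym e)) (~-sym d)))

    fold-unfold : (e : HypHom Y X) → fun e ≗ focusFun X → ∀ p → mapPlay e (unfold p) ≋ p
    fold-unfold e eq = go
      where
      lem : ∀ p → image (fun e) (cell p) ≐ last p
      lem p = ≐-trans {U = image (fun e) (cell p)} {image (focusFun X) (cell p)} {last p}
                (image-≗ {f = fun e} {focusFun X} {cell p} eq) (image-focus-cell p)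
      go : ∀ p → mapPlay e (unfold p) ≋ p
      go p@([ _ ]) = [ lem p ]
      go p@(q ▷ _) = go q ▷ lem p

  unfold-unfold : ∀ {X} (C : Celled X) (D : Celled (Celled.hypergraph C))
    (d : HypHom (Celled.hypergraph C) (Celled.hypergraph D)) → fun d ≗ Unfold.δFun C →
    ∀ p → mapPlay d (Unfold.unfold C p) ≋ Unfold.unfold D (Unfold.unfold C p)
  unfold-unfold C D d eq = go
    where
    module C = Unfold C
    module D = Unfold D
    lem : ∀ p → image (fun d) (cell p) ≐ cell (C.unfold p)
    lem p = ≐-trans {U = image (fun d) (cell p)} {image C.δFun (cell p)} {cell (C.unfold p)}
              (image-≗ {f = fun d} {C.δFun} {cell p} eq) (C.image-δ-cell p)
    go : ∀ p → mapPlay d (C.unfold p) ≋ D.unfold (C.unfold p)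
    go p@([ _ ]) = [ lem p ]
    go p@(q ▷ _) = go q ▷ lem p

  unfold-natural : ∀ {X Y} (C : Celled X) (D : Celled Y) (f : HypHom X Y)
    (g : HypHom (Celled.hypergraph C) (Celled.hypergraph D)) → fun g ≗ mapClasses f →
    ∀ p → Unfold.unfold D (mapPlay f p) ≋ mapPlay g (Unfold.unfold C p)
  unfold-natural C D f g eq p = ≋-sym (go p)
    where
    module C = Unfold C
    module D = Unfold D
    lem : ∀ p → image (fun g) (cell p) ≐ cell (mapPlay f p)
    lem p = ≐-trans {U = image (fun g) (cell p)} {image (mapClasses f) (cell p)}
              {cell (mapPlay f p)}
              (image-≗ {f = fun g} {mapClasses f} {cell p} eq) (image-cell f p)
    go : ∀ p → mapPlay g (C.unfold p) ≋ D.unfold (mapPlay f p)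
    go p@([ _ ]) = [ lem p ]
    go p@(q ▷ _) = go q ▷ lem p

  ℍ-celled : (X : Hypergraph) → Celled X
  ℍ-celled X = record
    { Edge*      = λ S → ∃[ p ] S ≐ cell {X} p
    ; Edge*-resp = λ {S} {T} e (p , d) → p , ≐-trans {U = T} {S} {cell p} (≐-sym {U = S} {T} e) d
    ; cell-edge  = λ p → p , ≐-refl {U = cell p}
    }

  ℍ₀ : Hypergraph → Hypergraph
  ℍ₀ X = Celled.hypergraph (ℍ-celled X)

  ℍ₁ : ∀ {X Y} → HypHom X Y → HypHom (ℍ₀ X) (ℍ₀ Y)
  ℍ₁ f = record
    { fun       = mapClasses f
    ; pres-edge = λ {S} (p , d) → mapPlay f p ,
        ≐-trans {U = image (mapClasses f) S} {image (mapClasses f) (cell p)}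
          {cell (mapPlay f p)}
          (image-resp (mapClasses f) {S} {cell p} d) (image-cell f p)
    }

  ℍ-ε : ∀ X → HypHom (ℍ₀ X) X
  ℍ-ε X = record
    { fun       = focusFun X
    ; pres-edge = λ {S} (p , d) → Edge-resp X
        (≐-sym {U = image (focusFun X) S} {last p}
          (≐-trans {U = image (focusFun X) S} {image (focusFun X) (cell p)} {last p}
            (image-resp (focusFun X) {S} {cell p} d) (image-focus-cell p)))
        (last-edge p)
    }

  ℍ-δ : ∀ X → HypHom (ℍ₀ X) (ℍ₀ (ℍ₀ X))
  ℍ-δ X = record
    { fun       = δFun
    ; pres-edge = λ {S} (p , d) → unfold p ,
        ≐-trans {U = image δFun S} {image δFun (cell p)} {cell (unfold p)}
          (image-resp δFun {S} {cell p} d) (image-δ-cell p)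
    }
    where open Unfold (ℍ-celled X)

  ℍ-functor : Functor Hyp Hyp
  ℍ-functor = record
    { F₀           = ℍ₀
    ; F₁           = ℍ₁
    ; identity     = λ {X} x → ≋⇒~ (mapPlay-id _ (λ _ → Setoid.refl (Vertex X)) (play x))
                                   (Setoid.refl (Vertex X))
    ; homomorphism = λ {_} {_} {Z} {f} {g} x →
        ≋⇒~ (mapPlay-∘ _ g f (λ _ → Setoid.refl (Vertex Z)) (play x))
            (Setoid.refl (Vertex Z))
    ; F-resp-≈     = λ {_} {_} {f} {g} e x → ≋⇒~ (mapPlay-≗ f g e (play x)) (e (focus x))
    }

  ℍ : Comonad Hyp
  ℍ = record
    { functor = ℍ-functor
    ; counit  = record
        { η       = ℍ-ε
        ; commute = λ {_} {Y} f x → Setoid.refl (Vertex Y)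
        }
    ; comult  = record
        { η       = ℍ-δ
        ; commute = λ {X} {Y} f x →
            ≋⇒~ (unfold-natural (ℍ-celled X) (ℍ-celled Y) f (ℍ₁ f) (λ _ → ~-refl) (play x))
                ~-refl
        }
    ; counitˡ = λ {X} x →
        ≋⇒~ (Unfold.fold-unfold (ℍ-celled X) (ℍ-ε X)
              (λ _ → Setoid.refl (Vertex X)) (play x))
            (Setoid.refl (Vertex X))
    ; counitʳ = λ x → ~-refl
    ; coassoc = λ {X} x →
        ≋⇒~ (unfold-unfold (ℍ-celled X) (ℍ-celled (ℍ₀ X)) (ℍ-δ X)
              (λ _ → ~-refl) (play x))
            ~-refl
    }

  module _ (σ : Vocabulary ℓ) where

    open Vocabulary σ

    record Structure : Set (lsuc ℓ) where
      field
        Universe : Setoid ℓ ℓ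
        rel      : (R : Symbol) → Vector ∣ Universe ∣ (arity R) → Set ℓ
        rel-resp : ∀ R {v w} → (∀ i → Setoid._≈_ Universe (v i) (w i)) →
                   rel R v → rel R w

    open Structure

    record StrHom (A B : Structure) : Set ℓ where
      field
        sfun     : Func (Universe A) (Universe B)
        pres-rel : ∀ {R v} → rel A R v → rel B R (to sfun ∘ v)

    open StrHom

    Str : Category (lsuc ℓ) ℓ ℓ
    Str = record
      { Obj       = Structure
      ; _⇒_       = StrHom
      ; _≈_       = λ f g → sfun f ≗ sfun g
      ; id        = record { sfun = idFun ; pres-rel = λ r → r }
      ; _∘C_      = λ g f → record
          { sfun = sfun g ∘Fun sfun f ; pres-rel = λ r → pres-rel g (pres-rel f r) }
      ; assoc     = λ {_} {_} {_} {D} x → Setoid.refl (Universe D)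
      ; identityˡ = λ {_} {B} x → Setoid.refl (Universe B)
      ; identityʳ = λ {_} {B} x → Setoid.refl (Universe B)
      ; equiv     = On.isEquivalence sfun ≗-equiv
      ; ∘-resp-≈  = λ {_} {_} {C} {_} {h} p q x →
          Setoid.trans (Universe C) (p _) (cong (sfun h) (q x))
      }

    module Guards (A : Structure) where

      open Setoid (Universe A) using (_≈_)
      open ListMembership (Universe A) using () renaming (_∈_ to _∈ₗ_)

      NonEmpty : Subset (Universe A) → Set ℓ
      NonEmpty U = ∃[ a ] a ∈ U

      -- A guard is a formula, with finitely many free variables, so all guarded
      -- sets are finite.  For loose and clique guarding this is imposed; an
      -- infinite clique of 𝔾 A need not lie over a single play.
      Finite : Subset (Universe A) → Set ℓ
      Finite U = Σ[ as ∈ List ∣ Universe A ∣ ]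
                   (∀ {x} → x ∈ U → x ∈ₗ as) × (∀ {x} → x ∈ₗ as → x ∈ U)

      Occurs : ∣ Universe A ∣ → ∀ {n} → Vector ∣ Universe A ∣ n → Set ℓ
      Occurs a v = ∃[ i ] v i ≈ a

      -- U is the set of elements of an atom that holds in A.  Equality atoms
      -- count as atoms, so singletons are included.
      AtomGuarded : Subset (Universe A) → Set ℓ
      AtomGuarded U =
          (∃[ a ] (∀ {x} → x ∈ U → a ≈ x) × (∀ {x} → a ≈ x → x ∈ U))
        ⊎ (∃[ R ] ∃[ v ] rel A R v
             × (∀ {x} → x ∈ U → Occurs x v) × (∀ {x} → Occurs x v → x ∈ U))

      LooselyGuarded : Subset (Universe A) → Set ℓ
      LooselyGuarded U = Finite U ×
        (∀ {a b} → a ∈ U → b ∈ U → ¬ a ≈ b →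
           ∃[ R ] ∃[ v ] rel A R v × Occurs a v × Occurs b v × (∀ i → v i ∈ U))

      Gaifman : ∣ Universe A ∣ → ∣ Universe A ∣ → Set ℓ
      Gaifman a b = ¬ a ≈ b × (∃[ R ] ∃[ v ] rel A R v × Occurs a v × Occurs b v)

      CliqueGuarded : Subset (Universe A) → Set ℓ
      CliqueGuarded U = Finite U ×
        (∀ {a b} → a ∈ U → b ∈ U → ¬ a ≈ b → Gaifman a b)

      GuardedBy : Guarding → Subset (Universe A) → Set ℓ
      GuardedBy atom   = AtomGuarded
      GuardedBy loose  = LooselyGuarded
      GuardedBy clique = CliqueGuarded

      Guarded : Guarding → Subset (Universe A) → Set ℓ
      Guarded 𝔤 U = NonEmpty U × GuardedBy 𝔤 U

      Finite-resp : ∀ {U W} → U ≐ W → Finite U → Finite W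
      Finite-resp (i , j) (as , f , g) = as , (λ m → f (j m)) , (λ m → i (g m))

      Guarded-resp : ∀ 𝔤 {U W} → U ≐ W → Guarded 𝔤 U → Guarded 𝔤 W
      Guarded-resp 𝔤 {U} {W} (i , j) ((a , a∈U) , g) = (a , i a∈U) , resp 𝔤 g
        where
        resp : ∀ 𝔤 → GuardedBy 𝔤 U → GuardedBy 𝔤 W
        resp atom (inj₁ (b , f , h)) = inj₁ (b , (λ m → f (j m)) , (λ e → i (h e)))
        resp atom (inj₂ (R , v , r , f , h)) =
          inj₂ (R , v , r , (λ m → f (j m)) , (λ e → i (h e)))
        resp loose (fin , f) = Finite-resp {U} {W} (i , j) fin , λ m n a≉b →
          let (R , v , r , p , q , k) = f (j m) (j n) a≉b in R , v , r , p , q , λ t → i (k t)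
        resp clique (fin , f) = Finite-resp {U} {W} (i , j) fin , λ m n → f (j m) (j n)

    open Guards using (Guarded; GuardedBy; Finite; Guarded-resp)

    Finite-image : (A B : Structure) (f : Func (Universe A) (Universe B)) (U : Subset (Universe A)) →
                   Finite A U → Finite B (image f U)
    Finite-image A B f U (as , k , l) =
        map (to f) as
      , (λ m → let (x , n , e) = ∈-image⁻ f U m in mapAny e (k n))
      , (λ m → let (x , n , e) = unmapAny as m in ∈-image⁺ f U (l n) e)
      where
      module A = Setoid (Universe A)
      module B = Setoid (Universe B)
      mapAny : ∀ {x y as} → to f x B.≈ y → Any (x A.≈_) as → Any (y B.≈_) (map (to f) as)
      mapAny e (here d)  = here (B.trans (B.sym e) (cong f d))
      mapAny e (there m) = there (mapAny e m)
      unmapAny : ∀ {y} as → Any (y B.≈_) (map (to f) as) →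
                 ∃[ x ] Any (x A.≈_) as × (to f x B.≈ y)
      unmapAny (a ∷ as) (here d)  = a , here A.refl , B.sym d
      unmapAny (a ∷ as) (there m) = let (x , n , e) = unmapAny as m in x , there n , e

    Guarded-image : ∀ 𝔤 {A B} (h : StrHom A B) {U} →
                    Guarded A 𝔤 U → Guarded B 𝔤 (image (sfun h) U)
    Guarded-image 𝔤 {A} {B} h {U} ((a₀ , a₀∈U) , g) =
      (to f a₀ , ∈-image⁺ f U a₀∈U B.refl) , im 𝔤 g
      where
      module A = Setoid (Universe A)
      module B = Setoid (Universe B)
      f = sfun h
      im : ∀ 𝔤 → GuardedBy A 𝔤 U → GuardedBy B 𝔤 (image f U)
      im atom (inj₁ (b , i , j)) = inj₁ (to f b
        , (λ m → let (x , n , e) = ∈-image⁻ f U m in B.trans (cong f (i n)) e)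
        , (λ e → ∈-image⁺ f U (j A.refl) e))
      im atom (inj₂ (R , v , r , i , j)) = inj₂ (R , to f ∘ v , pres-rel h r
        , (λ m → let (x , n , e) = ∈-image⁻ f U m
                     (k , d)     = i n
                 in k , B.trans (cong f d) e)
        , (λ (k , e) → ∈-image⁺ f U (j (k , A.refl)) e))
      im loose (fin , i) = Finite-image A B f U fin , λ m n ne →
        let (x , x∈U , d) = ∈-image⁻ f U m
            (y , y∈U , e) = ∈-image⁻ f U n
            (R , v , r , (k , p) , (l , q) , in-U) =
              i x∈U y∈U (λ x≈y → ne (B.trans (B.sym d) (B.trans (cong f x≈y) e)))
        in R , to f ∘ v , pres-rel h r , (k , B.trans (cong f p) d) , (l , B.trans (cong f q) e)
           , λ t → ∈-image⁺ f U (in-U t) B.refl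
      im clique (fin , i) = Finite-image A B f U fin , λ m n ne →
        let (x , x∈U , d) = ∈-image⁻ f U m
            (y , y∈U , e) = ∈-image⁻ f U n
            (_ , R , v , r , (k , p) , (l , q)) =
              i x∈U y∈U (λ x≈y → ne (B.trans (B.sym d) (B.trans (cong f x≈y) e)))
        in ne , R , to f ∘ v , pres-rel h r
           , (k , B.trans (cong f p) d) , (l , B.trans (cong f q) e)

    module _ (𝔤 : Guarding) where

      H₀ : Structure → Hypergraph
      H₀ A = record
        { Vertex = Universe A ; Edge = Guarded A 𝔤 ; Edge-resp = Guarded-resp A 𝔤 }

      H₁ : ∀ {A B} → StrHom A B → HypHom (H₀ A) (H₀ B)
      H₁ h = record { fun = sfun h ; pres-edge = Guarded-image 𝔤 h }

      H : Functor Str Hyp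
      H = record
        { F₀           = H₀
        ; F₁           = H₁
        ; identity     = λ {A} x → Setoid.refl (Universe A)
        ; homomorphism = λ {_} {_} {Z} x → Setoid.refl (Universe Z)
        ; F-resp-≈     = λ e → e
        }

      𝔾₀ : Structure → Structure
      𝔾₀ A = record
        { Universe = Classes (H₀ A)
        ; rel      = λ R u → Σ[ p ∈ Play (H₀ A) ] Σ[ v ∈ Vector ∣ Universe A ∣ (arity R) ]
                       Σ[ m ∈ (∀ i → v i ∈ last p) ]
                       rel A R v × (∀ i → u i ~ (⟨ p , v i ⟩∋ m i))
        ; rel-resp = λ R e (p , v , m , r , d) → p , v , m , r , λ i → ~-trans (~-sym (e i)) (d i)
        }

      𝔾₁ : ∀ {A B} → StrHom A B → StrHom (𝔾₀ A) (𝔾₀ B)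
      𝔾₁ h = record
        { sfun     = mapClasses (H₁ h)
        ; pres-rel = λ (p , v , m , r , d) →
            mapPlay (H₁ h) p , to (sfun h) ∘ v , (λ i → ∈-last-map⁺ (H₁ h) p (m i))
            , pres-rel h r , λ i → cong (mapClasses (H₁ h)) (d i)
        }

      𝔾-ε : ∀ A → StrHom (𝔾₀ A) A
      𝔾-ε A = record
        { sfun     = focusFun (H₀ A)
        ; pres-rel = λ {R} (p , v , m , r , d) →
            rel-resp A R (λ i → Setoid.sym (Universe A) (_~_.focus≈ (d i))) r
        }

    Finite-cell : ∀ 𝔤 {A} (p : Play (H₀ 𝔤 A)) → Finite A (last p) → Finite (𝔾₀ 𝔤 A) (cell p)
    Finite-cell 𝔤 {A} p (as , k , l) = attach as l
      , (λ n → let (a , m , d) = ∈-cell⁻ p n in attach⁺ as l d (k m))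
      , (λ n → let (a , m , d) = attach⁻ as l n in ∈-cell⁺ p m d)
      where
      module A = Setoid (Universe A)
      FP = FocussedPlay (H₀ 𝔤 A)
      attach : ∀ as → (∀ {x} → Any (x A.≈_) as → x ∈ last p) → List FP
      attach []       l = []
      attach (a ∷ as) l = (⟨ p , a ⟩∋ l (here A.refl)) ∷ attach as (λ n → l (there n))
      attach⁺ : ∀ as (l : ∀ {x} → Any (x A.≈_) as → x ∈ last p) {x a} {m : a ∈ last p} →
                x ~ (⟨ p , a ⟩∋ m) → Any (a A.≈_) as → Any (x ~_) (attach as l)
      attach⁺ (a ∷ as) l d (here e)  = here (~-trans d (≋⇒~ ≋-refl e))
      attach⁺ (a ∷ as) l d (there n) = there (attach⁺ as (λ n → l (there n)) d n)
      attach⁻ : ∀ as (l : ∀ {x} → Any (x A.≈_) as → x ∈ last p) {x} → Any (x ~_) (attach as l) →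
                ∃[ a ] Σ[ m ∈ a ∈ last p ] x ~ (⟨ p , a ⟩∋ m)
      attach⁻ (a ∷ as) l (here d)  = a , l (here A.refl) , d
      attach⁻ (a ∷ as) l (there n) = attach⁻ as (λ n → l (there n)) n

    support-clique : ∀ {A} R (v : Vector ∣ Universe A ∣ (arity R)) → rel A R v →
                     ∀ {a} → Guards.Occurs A a v →
                     Σ[ V ∈ ∃ (Guarded A clique) ] (∀ i → v i ∈ proj₁ V)
    support-clique {A} R v r {a} (i₀ , e₀) =
        (V , (a , ∈-compr⁺ P P-resp (i₀ , e₀))
           , (tabulate v , (λ m → let (i , e) = ∈-compr⁻ P P-resp m in tab⁺ v i e)
                          , (λ m → ∈-compr⁺ P P-resp (tab⁻ v m)))
           , λ m n ne → ne , R , v , r , ∈-compr⁻ P P-resp m , ∈-compr⁻ P P-resp n)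
      , λ i → ∈-compr⁺ P P-resp (i , A.refl)
      where
      module A = Setoid (Universe A)
      P : ∣ Universe A ∣ → Set ℓ
      P x = Guards.Occurs A x v
      P-resp : ∀ {x y} → x A.≈ y → P x → P y
      P-resp e (i , d) = i , A.trans d e
      V : Subset (Universe A)
      V = compr P P-resp
      tab⁺ : ∀ {n} (v : Vector ∣ Universe A ∣ n) {x} i → v i A.≈ x → Any (x A.≈_) (tabulate v)
      tab⁺ v Fin.zero    e = here (A.sym e)
      tab⁺ v (Fin.suc i) e = there (tab⁺ (v ∘ Fin.suc) i e)
      tab⁻ : ∀ {n} (v : Vector ∣ Universe A ∣ n) {x} → Any (x A.≈_) (tabulate v) →
             ∃[ i ] v i A.≈ x
      tab⁻ {suc n} v (here e)  = Fin.zero , A.sym e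
      tab⁻ {suc n} v (there m) = let (i , e) = tab⁻ (v ∘ Fin.suc) m in Fin.suc i , e

    Guarded-cell : ∀ 𝔤 {A} (p : Play (H₀ 𝔤 A)) → Guarded (𝔾₀ 𝔤 A) 𝔤 (cell p)
    Guarded-cell 𝔤 {A} p = nonEmpty (last-edge p) , guarded 𝔤 p (proj₂ (last-edge p))
      where
      module A = Setoid (Universe A)
      nonEmpty : Guarded A 𝔤 (last p) → Guards.NonEmpty (𝔾₀ 𝔤 A) (cell p)
      nonEmpty ((a , m) , _) = (⟨ p , a ⟩∋ m) , ∈-cell⁺ p m ~-refl
      guarded : ∀ 𝔤 (p : Play (H₀ 𝔤 A)) → GuardedBy A 𝔤 (last p) →
                GuardedBy (𝔾₀ 𝔤 A) 𝔤 (cell p)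
      guarded atom p (inj₁ (a , i , j)) = inj₁ ((⟨ p , a ⟩∋ j A.refl)
        , (λ n → let (b , m , d) = ∈-cell⁻ p n in ~-trans (≋⇒~ ≋-refl (i m)) (~-sym d))
        , (λ e → ∈-cell⁺ p (j A.refl) (~-sym e)))
      guarded atom p (inj₂ (R , v , r , i , j)) = inj₂ (R
        , (λ k → ⟨ p , v k ⟩∋ j (k , A.refl))
        , (p , v , (λ k → j (k , A.refl)) , r , λ _ → ~-refl)
        , (λ n → let (b , m , d) = ∈-cell⁻ p n
                     (k , e)     = i m
                 in k , ~-trans (≋⇒~ ≋-refl e) (~-sym d))
        , (λ (k , e) → ∈-cell⁺ p (j (k , A.refl)) (~-sym e)))
      guarded loose p (fin , i) = Finite-cell loose {A} p fin , λ x∈ y∈ ne →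
        let (a , m , d) = ∈-cell⁻ p x∈
            (b , n , e) = ∈-cell⁻ p y∈
            (R , v , r , (k , s) , (l , t) , u) =
              i m n (λ a≈b → ne (~-trans d (~-trans (≋⇒~ ≋-refl a≈b) (~-sym e))))
        in R , (λ k → ⟨ p , v k ⟩∋ u k) , (p , v , u , r , λ _ → ~-refl)
           , (k , ~-trans (≋⇒~ ≋-refl s) (~-sym d))
           , (l , ~-trans (≋⇒~ ≋-refl t) (~-sym e))
           , λ k → ∈-cell⁺ p (u k) ~-refl
      guarded clique p (fin , i) = Finite-cell clique {A} p fin , λ x∈ y∈ ne →
        let (a , m , d) = ∈-cell⁻ p x∈
            (b , n , e) = ∈-cell⁻ p y∈
            (_ , R , v , r , (k , s) , (l , t)) =
              i m n (λ a≈b → ne (~-trans d (~-trans (≋⇒~ ≋-refl a≈b) (~-sym e))))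
            (V , v∈V) = support-clique {A} R v r (k , s)
            a∈V = ∈-resp (proj₁ V) s (v∈V k)
            b∈V = ∈-resp (proj₁ V) t (v∈V l)
        in ne , R , (λ k → ⟨ p ▷ V , v k ⟩∋ v∈V k) , (p ▷ V , v , v∈V , r , λ _ → ~-refl)
           , (k , ~-trans (≋⇒~ ≋-refl s) (~-trans (~-sym (~-extend p V m a∈V)) (~-sym d)))
           , (l , ~-trans (≋⇒~ ≋-refl t) (~-trans (~-sym (~-extend p V n b∈V)) (~-sym e)))

    module _ (𝔤 : Guarding) where

      𝔾-celled : (A : Structure) → Celled (H₀ 𝔤 A)
      𝔾-celled A = record
        { Edge*      = Guarded (𝔾₀ 𝔤 A) 𝔤
        ; Edge*-resp = Guarded-resp (𝔾₀ 𝔤 A) 𝔤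
        ; cell-edge  = Guarded-cell 𝔤 {A}
        }

      𝔾-δ : ∀ A → StrHom (𝔾₀ 𝔤 A) (𝔾₀ 𝔤 (𝔾₀ 𝔤 A))
      𝔾-δ A = record
        { sfun     = δFun
        ; pres-rel = λ (p , v , m , r , d) →
            unfold p , (λ i → ⟨ p , v i ⟩∋ m i)
            , (λ i → ∈-unfold⁺ p (∈-cell⁺ p (m i) ~-refl))
            , (p , v , m , r , λ _ → ~-refl)
            , λ i → ~-trans (cong δFun (d i)) (≋⇒~ ≋-refl ~-refl)
        }
        where open Unfold (𝔾-celled A)

      𝔾-functor : Functor Str Str
      𝔾-functor = record
        { F₀           = 𝔾₀ 𝔤
        ; F₁           = 𝔾₁ 𝔤
        ; identity     = λ {A} x →
            ≋⇒~ (mapPlay-id _ (λ _ → Setoid.refl (Universe A)) (play x))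
                (Setoid.refl (Universe A))
        ; homomorphism = λ {_} {_} {Z} {f} {g} x →
            ≋⇒~ (mapPlay-∘ _ (H₁ 𝔤 g) (H₁ 𝔤 f) (λ _ → Setoid.refl (Universe Z)) (play x))
                (Setoid.refl (Universe Z))
        ; F-resp-≈     = λ {_} {_} {f} {g} e x →
            ≋⇒~ (mapPlay-≗ (H₁ 𝔤 f) (H₁ 𝔤 g) e (play x)) (e (focus x))
        }

      𝔾 : Comonad Str
      𝔾 = record
        { functor = 𝔾-functor
        ; counit  = record
            { η       = 𝔾-ε 𝔤
            ; commute = λ {_} {B} h x → Setoid.refl (Universe B)
            }
        ; comult  = record
            { η       = 𝔾-δ
            ; commute = λ {A} {B} h x →
                ≋⇒~ (unfold-natural (𝔾-celled A) (𝔾-celled B) (H₁ 𝔤 h) (H₁ 𝔤 (𝔾₁ 𝔤 h))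
                      (λ _ → ~-refl) (play x))
                    ~-refl
            }
        ; counitˡ = λ {A} x →
            ≋⇒~ (Unfold.fold-unfold (𝔾-celled A) (H₁ 𝔤 (𝔾-ε 𝔤 A))
                  (λ _ → Setoid.refl (Universe A)) (play x))
                (Setoid.refl (Universe A))
        ; counitʳ = λ x → ~-refl
        ; coassoc = λ {A} x →
            ≋⇒~ (unfold-unfold (𝔾-celled A) (𝔾-celled (𝔾₀ 𝔤 A)) (H₁ 𝔤 (𝔾-δ A))
                  (λ _ → ~-refl) (play x))
                ~-refl
        }

{-# OPTIONS --safe #-}

-- The guarded subsets of 𝔾 A are exactly the cells {[p,a] | a ∈ last p}, so θ is
-- the identity on vertices.  The plays p with x ∈ cell p form a connected part
-- of the prefix forest, and therefore consist of the plays reached by a walk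
-- from a least one, the root of x.  Any two elements of a guarded set S share a
-- cell, so their roots are comparable; the longest root r of S then satisfies
-- S ⊆ cell r (the Helly property of subtrees), and S is the cell of r extended
-- by the guarded set ε(S).

module Submission where

open import Defs
open import Axiom.ExcludedMiddle using (ExcludedMiddle)
open import Data.Bool using (T?)
open import Data.Empty using (⊥-elim)
open import Data.List using ([]; _∷_)
open import Data.List.Relation.Unary.All as All using (All; []; _∷_)
open import Data.Product using (Σ-syntax; ∃-syntax; _×_; _,_; proj₁; proj₂)
open import Data.Sum using (_⊎_; inj₁; inj₂)
open import Data.Vec.Functional using (Vector)
open import Function.Bundles using (Func)
open import Level using (Level)
open import Relation.Binary.Bundles using (Setoid)
open import Relation.Nullary using (¬_; Dec; yes; no)
open import Relation.Nullary.Decidable using (map′)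

-- Totality is asked only within `P`: roots of arbitrary classes may be incomparable, those of
-- classes in a guarded set are not.
greatest-of-list : ∀ {a p r} {A : Set a} {P : A → Set p} (R : A → A → Set r) →
  (∀ {x} → R x x) → (∀ {x y z} → R x y → R y z → R x z) →
  (∀ {x y} → P x → P y → R x y ⊎ R y x) →
  ∀ {x xs} → All P (x ∷ xs) → ∃[ m ] P m × All (λ y → R y m) (x ∷ xs)
greatest-of-list R rfl trns total {x} {[]} (px ∷ []) = x , px , rfl ∷ []
greatest-of-list R rfl trns total {x} {_ ∷ _} (px ∷ pxs)
  with greatest-of-list R rfl trns total pxs
... | m , pm , below with total px pm
...   | inj₁ x≤m = m , pm , x≤m ∷ below
...   | inj₂ m≤x = x , px , rfl ∷ All.map (λ y≤m → trns y≤m m≤x) below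

module _ {ℓ : Level} (em : ExcludedMiddle ℓ) where

  open Classical em
  open Hypergraph
  open HypHom
  open FocussedPlay

  ⊑-comparable : ∀ {X} {p q r : Play X} → p ⊑ r → q ⊑ r → p ⊑ q ⊎ q ⊑ p
  ⊑-comparable (⊑-reflexive e) q⊑r = inj₂ (⊑-respʳ q⊑r (≋-sym e))
  ⊑-comparable p⊑r@(⊑-step _) (⊑-reflexive e) = inj₁ (⊑-respʳ p⊑r (≋-sym e))
  ⊑-comparable (⊑-step p⊑r) (⊑-step q⊑r) = ⊑-comparable p⊑r q⊑r

  walk-prefix : ∀ {X a} {r s p : Play X} → Walk a r p → r ⊑ s → s ⊑ p → Walk a r s
  walk-prefix w r⊑s s⊑p =
    along⇒walk r⊑s (λ t r⊑t t⊑s → walk⇒along w r⊑t (⊑-trans t⊑s s⊑p))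

  walk-end : ∀ {X a} {r p : Play X} → Walk a r p → a ∈ last p
  walk-end w = walk⇒along w (walk⇒⊑ w) (⊑-reflexive ≋-refl)

  _∈?_ : ∀ {V : Setoid ℓ ℓ} (x : ∣ V ∣) (U : Subset V) → Dec (x ∈ U)
  x ∈? U = map′ mem _∈_.holds (T? (Func.to U x))

  -- Retreat from `p` while the last set still contains `a`; no walk of `a` to `p` can start
  -- earlier.
  least-walk : ∀ {X a} (p : Play X) → a ∈ last p →
               ∃[ r ] Walk a r p × (∀ {s} → Walk a s p → Walk a r s)
  least-walk p@([ _ ]) m = p , stay ≋-refl m , λ where
    (stay e _) → stay (≋-sym e) (proj₂ (≋-last e) m)
  least-walk {a = a} (p ▷ U) m with a ∈? last p
  ... | yes a∈p =
    let (r , w , least) = least-walk p a∈p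
    in r , step w m , λ where
         (stay e _) → walk-respʳ (≋-sym e) (step w m)
         (step v _) → least v
  ... | no a∉p = p ▷ U , stay ≋-refl m , λ where
    (stay e _) → stay (≋-sym e) (proj₂ (≋-last e) m)
    (step v _) → ⊥-elim (a∉p (walk-end v))

  root : ∀ {X} → FocussedPlay X → Play X
  root x = proj₁ (least-walk (play x) (focus∈ x))

  ∈-cell⇒walk : ∀ {X} {x : FocussedPlay X} q → x ∈ cell q → Walk (focus x) (root x) q
  ∈-cell⇒walk {x = x} q x∈q =
    let (_ , _ , x~)    = ∈-cell⁻ q x∈q
        (_ , w , v)     = ~⇒walks x~
        (_ , _ , least) = least-walk (play x) (focus∈ x)
    -- A common start of walks to `play x` and `q` is reached from the root by leastness; then walk
    -- on to `q`.
    in walk-trans (least w) v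

  walk⇒∈-cell : ∀ {X} {x : FocussedPlay X} q → Walk (focus x) (root x) q → x ∈ cell q
  walk⇒∈-cell {X} {x} q v =
    let (_ , w , _) = least-walk (play x) (focus∈ x)
    in ∈-cell⁺ q (walk-end v)
         (walks⇒~ (Setoid.refl (Vertex X)) w v)

  ShareCell : ∀ {X} → FocussedPlay X → FocussedPlay X → Set ℓ
  ShareCell x y = ∃[ q ] (x ∈ cell q) × (y ∈ cell q)

  roots-comparable : ∀ {X} {x y : FocussedPlay X} → ShareCell x y →
                     root x ⊑ root y ⊎ root y ⊑ root x
  roots-comparable (q , x∈q , y∈q) =
    ⊑-comparable (walk⇒⊑ (∈-cell⇒walk q x∈q)) (walk⇒⊑ (∈-cell⇒walk q y∈q))

  -- Since `root y` is a prefix of the shared play `q`, the walk of `x` from its root to `q` passes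
  -- through it.
  ∈-cell-root : ∀ {X} {x y : FocussedPlay X} → ShareCell x y → root x ⊑ root y →
                x ∈ cell (root y)
  ∈-cell-root {y = y} (q , x∈q , y∈q) x⊑y = walk⇒∈-cell (root y)
    (walk-prefix (∈-cell⇒walk q x∈q) x⊑y (walk⇒⊑ (∈-cell⇒walk q y∈q)))

  cell-helly : ∀ {X} (S : Subset (Classes X)) → (∀ {x y} → x ∈ S → y ∈ S → ShareCell x y) →
    ∀ {x xs} → All (_∈ S) (x ∷ xs) → ∃[ r ] All (_∈ cell r) (x ∷ xs)
  cell-helly S share xs⊆S =
    let (m , m∈S , below) = greatest-of-list (λ x y → root x ⊑ root y)
          (⊑-reflexive ≋-refl) ⊑-trans (λ x∈S y∈S → roots-comparable (share x∈S y∈S)) xs⊆S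
    in root m , All.zipWith (λ (x∈S , x⊑m) → ∈-cell-root (share x∈S m∈S) x⊑m) (xs⊆S , below)

  -- `S` may be a proper part of `cell p`; playing the set of its foci trims the cell to `S`. The
  -- extra move keeps the classes of `S`, and within one cell the focus determines the class.
  subset-of-cell : ∀ {X} (S : Subset (Classes X)) (p : Play X) → (∀ {x} → x ∈ S → x ∈ cell p) →
    (u : Edge X (image (focusFun X) S)) → S ≐ cell (p ▷ (image (focusFun X) S , u))
  subset-of-cell {X} S p S⊆p u = to-cell , from-cell
    where
    module V = Setoid (Vertex X)
    U = image (focusFun X) S
    p′ = p ▷ (U , u)
    at-focus : ∀ {x} → x ∈ S → Σ[ m ∈ focus x ∈ U ] x ~ (⟨ p′ , focus x ⟩∋ m)
    at-focus x∈S =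
      let (a , m , d) = ∈-cell⁻ p (S⊆p x∈S)
          x∈U         = ∈-image⁺ (focusFun X) S x∈S V.refl
          a∈U         = ∈-resp U (_~_.focus≈ d) x∈U
      in x∈U , ~-trans d (~-trans (~-extend p (U , u) m a∈U)
                                  (≋⇒~ ≋-refl (V.sym (_~_.focus≈ d))))
    to-cell : ∀ {x} → x ∈ S → x ∈ cell p′
    to-cell x∈S = let (m , d) = at-focus x∈S in ∈-cell⁺ p′ m d
    from-cell : ∀ {x} → x ∈ cell p′ → x ∈ S
    from-cell x∈ =
      let (a , m , d)   = ∈-cell⁻ p′ x∈
          (y , y∈S , e) = ∈-image⁻ (focusFun X) S m
          (_ , d′)      = at-focus y∈S
      in ∈-resp S (~-trans d′ (~-trans (≋⇒~ ≋-refl e) (~-sym d))) y∈S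

  -- This is naturality of `unfold` at the identity of `X`, whose action on classes is the identity
  -- up to `~`. It compares the two comultiplications.
  unfold-relabel : ∀ {X} (C D : Celled X)
    (f : HypHom (Celled.hypergraph C) (Celled.hypergraph D)) → fun f ≗ idFun →
    ∀ p → Unfold.unfold D p ≋ mapPlay f (Unfold.unfold C p)
  unfold-relabel {X} C D f f≗id p = ≋-trans
    (Unfold.unfold-cong D (≋-sym (mapPlay-id idX (λ _ → V.refl) p)))
    (unfold-natural C D idX f
      (λ x → ~-trans (f≗id x)
        (≋⇒~ (≋-sym (mapPlay-id idX (λ _ → V.refl) (play x))) V.refl)) p)
    where
    module V = Setoid (Vertex X)
    idX = Category.id Hyp {X}

  module _ (σ : Vocabulary ℓ) where

    open Structure
    open Guards using (Guarded; Finite)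

    module _ (𝔤 : Guarding) (A : Structure σ) where

      private
        X  = H₀ σ 𝔤 A
        𝔾A = 𝔾₀ σ 𝔤 A

      -- A related tuple of `𝔾A` lies, by definition, over a single play, the first component of
      -- `r`.
      support-in-cell : ∀ R (v : Vector (FocussedPlay X) (Vocabulary.arity σ R)) (r : rel 𝔾A R v)
        (x : FocussedPlay X) → Guards.Occurs σ 𝔾A x v → x ∈ cell (proj₁ r)
      support-in-cell R v (p , _ , m , _ , d) x (i , e) =
        ∈-cell⁺ p (m i) (~-trans (~-sym e) (d i))

      finite-in-cell : (S : Subset (Classes X)) → Guards.NonEmpty σ 𝔾A S → Finite σ 𝔾A S →
        (∀ x y → x ∈ S → y ∈ S → ¬ x ~ y → ShareCell x y) →
        ∃[ r ] (∀ {x} → x ∈ S → x ∈ cell r)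
      finite-in-cell S (x₀ , x₀∈S) ([] , as⊇ , as⊆) share with as⊇ x₀∈S
      ... | ()
      finite-in-cell S _ (_ ∷ _ , as⊇ , as⊆) share =
        let (r , all) = cell-helly S share′ (All.tabulateₛ (Classes X) as⊆)
        in r , λ x∈S → All.lookupₛ (Classes X) (∈-resp (cell r)) all (as⊇ x∈S)
        where
        share′ : ∀ {x y} → x ∈ S → y ∈ S → ShareCell x y
        -- Loose and clique guards constrain distinct elements only; equal classes share the cell of
        -- either representative.
        share′ {x} {y} x∈S y∈S with em {P = x ~ y}
        ... | yes x~y = play y , ∈-cell⁺ (play y) (focus∈ y) x~y
                               , ∈-cell⁺ (play y) (focus∈ y) ~-refl
        ... | no  x≁y = share x y x∈S y∈S x≁y

    guarded-in-cell : ∀ 𝔤 A (S : Subset (Classes (H₀ σ 𝔤 A))) → Guarded σ (𝔾₀ σ 𝔤 A) 𝔤 S →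
                      ∃[ r ] (∀ {x} → x ∈ S → x ∈ cell r)
    guarded-in-cell atom A S (_ , inj₁ (b , b≈ , _)) =
      play b , λ x∈S → ∈-cell⁺ (play b) (focus∈ b) (~-sym (b≈ x∈S))
    guarded-in-cell atom A S (_ , inj₂ (R , v , r , occurs , _)) =
      proj₁ r , λ {x} x∈S → support-in-cell atom A R v r x (occurs x∈S)
    guarded-in-cell loose A S (ne , fin , f) =
      finite-in-cell loose A S ne fin λ x y x∈S y∈S x≁y →
        let (R , v , r , o , o′ , _) = f x∈S y∈S x≁y
        in proj₁ r , support-in-cell loose A R v r x o , support-in-cell loose A R v r y o′
    guarded-in-cell clique A S (ne , fin , f) =
      finite-in-cell clique A S ne fin λ x y x∈S y∈S x≁y →
        let (_ , R , v , r , o , o′) = f x∈S y∈S x≁y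
        in proj₁ r , support-in-cell clique A R v r x o , support-in-cell clique A R v r y o′

    module _ (𝔤 : Guarding) (A : Structure σ) where

      guarded⇒cell : ∀ {S} → Guarded σ (𝔾₀ σ 𝔤 A) 𝔤 S → ∃[ p ] S ≐ cell {H₀ σ 𝔤 A} p
      guarded⇒cell {S} g =
        let (r , S⊆r) = guarded-in-cell 𝔤 A S g
        -- The added move is the image of `S` under the counit, guarded because homomorphisms
        -- preserve guardedness.
        in r ▷ _ , subset-of-cell S r S⊆r (Guarded-image σ 𝔤 {𝔾₀ σ 𝔤 A} {A} (𝔾-ε σ 𝔤 A) g)

      θ-fun : HypHom (H₀ σ 𝔤 (𝔾₀ σ 𝔤 A)) (ℍ₀ (H₀ σ 𝔤 A))
      θ-fun = record
        { fun       = idFun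
        ; pres-edge = λ {S} g → Edge-resp (ℍ₀ (H₀ σ 𝔤 A)) {S} {image idFun S}
            (≐-sym {U = image idFun S} {S} (image-id {U = S})) (guarded⇒cell g)
        }

      θ⁻¹-fun : HypHom (ℍ₀ (H₀ σ 𝔤 A)) (H₀ σ 𝔤 (𝔾₀ σ 𝔤 A))
      θ⁻¹-fun = record
        { fun       = idFun
        ; pres-edge = λ {S} (p , S≐p) → Edge-resp (H₀ σ 𝔤 (𝔾₀ σ 𝔤 A)) {cell p} {image idFun S}
            (≐-sym {U = image idFun S} {cell p}
              (≐-trans {U = image idFun S} {S} {cell p} (image-id {U = S}) S≐p))
            (Guarded-cell σ 𝔤 {A} p)
        }

theorem6p3 : {ℓ : Level} (em : ExcludedMiddle ℓ) (σ : Vocabulary ℓ) (𝔤 : Guarding) →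
    let open Classical em in
    Σ[ θ ∈ NaturalIsomorphism (H σ 𝔤 ∘F Comonad.functor (𝔾 σ 𝔤)) (Comonad.functor ℍ ∘F H σ 𝔤) ]
    IsEilenbergMooreLaw (𝔾 σ 𝔤) ℍ (H σ 𝔤) (NaturalIsomorphism.F⇒G θ)
theorem6p3 em σ 𝔤 =
    record
      -- Both composite functors act on classes by `mapClasses`, so naturality is reflexivity.
      { F⇒G  = record { η = θ-fun em σ 𝔤 ; commute = λ f x → ~-refl }
      ; η⁻¹  = θ⁻¹-fun em σ 𝔤
      ; isoˡ = λ A x → ~-refl
      ; isoʳ = λ A x → ~-refl
      }
  , record
      { counit-law = λ A x → Setoid.refl (Structure.Universe A)
      -- Both sides have focus `x`; their plays unfold `play x` with cells as hyperedges of `ℍ` and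
      -- as guarded sets relabelled along θ.
      ; comult-law = λ A x → ≋⇒~
          (unfold-relabel em (𝔾-celled σ 𝔤 A) (ℍ-celled (H₀ σ 𝔤 A)) (θ-fun em σ 𝔤 A)
            (λ _ → ~-refl) (FocussedPlay.play x))
          ~-refl
      }
  where open Classical em
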